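{- Let $Y$ be a set and let $\alpha: Y \to Y$ be a function without a fixed point (i.e., $\alpha(y) \neq y$ for all $y \in Y$). Let $T$ and $S$ be sets and let $\beta: T \to S$ be a function that is onto, i.e., has a right inverse $\bar{\beta}: S \to T$ (so $\beta(\bar{\beta}(s)) = s$ for all $s \in S$). Then for every function $f: T \times S \to Y$, the function $g_\beta: T \to Y$ defined by $$g_\beta(t) = \alpha\bigl(f(t, \beta(t))\bigr) \quad \text{for all } t \in T$$ is not representable by $f$; that is, for all $s \in S$, $g_\beta(-) \neq f(-, s)$ as functions $T \to Y$.
   Context: For a function $f: T \times S \to Y$ and an element $s \in S$, $f(-,s): T \to Y$ denotes the function $t \mapsto f(t,s)$. A function $g: T \to Y$ is called representable by $f$ if there exists $s_0 \in S$ such that $g(-) = f(-, s_0)$, i.e., $g(t) = f(t, s_0)$ for all $t \in T$. The function $g_\beta$ is the composite of $\langle \mathrm{Id}, \beta \rangle : T \to T \times S$, $t \mapsto (t, \beta(t))$, followed by $f: T \times S \to Y$, followed by $\alpha: Y \to Y$. -}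

module Defs where

open import Data.Product using (_×_; _,_; ∃; <_,_>)
open import Function using (_∘_; id; StrictlyInverseˡ)
open import Level using (Level; _⊔_)
open import Relation.Binary.PropositionalEquality using (_≡_; _≢_; _≗_)

private
  variable
    y t s : Level
    Y : Set y
    T : Set t
    S : Set s

FixedPointFree : {Y : Set y} → (Y → Y) → Set y
FixedPointFree α = ∀ y → α y ≢ y

-- Ontoness is taken as the existence of a right inverse function.
Onto : {T : Set t} {S : Set s} → (T → S) → Set (t ⊔ s)
Onto {T = T} {S = S} β = ∃ λ (β̄ : S → T) → StrictlyInverseˡ _≡_ β β̄

infix 9 _⟨-,_⟩
_⟨-,_⟩ : (T × S → Y) → S → (T → Y)
(f ⟨-, s ⟩) t = f (t , s)

-- Functions are compared pointwise, as _≡_ on functions is not extensional.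
_Represents_ : {T : Set t} {S : Set s} {Y : Set y} →
               (T × S → Y) → (T → Y) → Set (t ⊔ s ⊔ y)
f Represents g = ∃ λ s₀ → g ≗ f ⟨-, s₀ ⟩

diagonal : (Y → Y) → (T → S) → (T × S → Y) → (T → Y)
diagonal α β f = α ∘ f ∘ < id , β >

{-# OPTIONS --safe #-}
module Submission where

open import Defs
open import Data.Product using (_×_; _,_)
open import Relation.Binary.PropositionalEquality using (_≡_; subst)
open import Relation.Nullary using (¬_)

-- Cantor's diagonal argument: if the diagonal function were `f ⟨-, s₀ ⟩`, evaluating both at a
-- preimage `t₀` of `s₀` under `β` would make `f (t₀ , s₀)` a fixed point of `α`.

theorem2 : ∀ {y t s} {Y : Set y} (α : Y → Y) → FixedPointFree α →
    {T : Set t} {S : Set s} (β : T → S) → Onto β →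
    (f : T × S → Y) → ¬ (f Represents diagonal α β f)
theorem2 α α-free β (β̄ , β∘β̄≗id) f (s₀ , g≗f⟨-,s₀⟩) =
  α-free (f (t₀ , s₀))
    -- At `t₀` the representation reads `α (f (t₀ , β t₀)) ≡ f (t₀ , s₀)`; transport along
    -- `β t₀ ≡ s₀` makes the two arguments of `f` agree.
    (subst (λ s → α (f (t₀ , s)) ≡ f (t₀ , s₀)) (β∘β̄≗id s₀) (g≗f⟨-,s₀⟩ t₀))
  where
  t₀ = β̄ s₀
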